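{- Let $\mathcal L=(\Sigma,X)$ be a language and $\Lambda$ a fuzzy theory in $\mathcal L$. Then the forgetful functor $\mathscr U_\Lambda:\mathbf{Mod}(\Lambda)\to\mathbf{Fuz}_H$ has a left adjoint $\mathscr F_\Lambda$; i.e. for every $H$-fuzzy set $(M,\mu_M)$ there is a model $\mathscr F_\Lambda(M,\mu_M)$ of $\Lambda$ and an arrow $\eta:(M,\mu_M)\to\mathscr U_\Lambda(\mathscr F_\Lambda(M,\mu_M))$ such that for every model $\mathcal B$ of $\Lambda$ and every arrow $g:(M,\mu_M)\to\mathscr U_\Lambda(\mathcal B)$ there is a unique morphism of $\Sigma$-algebras $\bar g:\mathscr F_\Lambda(M,\mu_M)\to\mathcal B$ with $\mathscr U_\Lambda(\bar g)\circ\eta=g$.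
   Context: $H$ is a frame with bottom $\bot$. An $H$-fuzzy set is a pair $(A,\mu_A)$ of a set $A$ and a function $\mu_A:A\to H$; an arrow $f:(A,\mu_A)\to(B,\mu_B)$ is a function with $\mu_A(x)\le\mu_B(f(x))$; they form $\mathbf{Fuz}_H$. For $n\ge1$, $(A,\mu_A)^n=(A^n,\mu)$ with $\mu(a_1,\dots,a_n)=\bigwedge_i\mu_A(a_i)$. A signature $\Sigma=(O,\mathrm{ar},C)$ consists of a set $O$ of operation symbols with arity $\mathrm{ar}:O\to\{1,2,3,\dots\}$ and a set $C$ of constant symbols. A language is a pair $\mathcal L=(\Sigma,X)$ with $X$ a set of variables. $\mathrm{Terms}(\mathcal L)$ is the smallest set containing $X\sqcup C$ and containing $f(t_1,\dots,t_{\mathrm{ar}(f)})$ whenever $f\in O$ and all $t_i\in\mathrm{Terms}(\mathcal L)$. A formula is either an equation $s\equiv t$ ($s,t$ terms) or a membership proposition $\mathsf E_l(t)$ with $l\in H$ and $t$ a term. A sequent $\Gamma\vdash\psi$ is a pair of a (possibly infinite) set $\Gamma$ of formulas and a formula $\psi$. A fuzzy theory in $\mathcal L$ is a set of sequents. A $\Sigma$-algebra $\mathcal A=((A,\mu_A),\Sigma^{\mathcal A})$ is an $H$-fuzzy set $(A,\mu_A)$ together with, for each $f\in O$, an arrow $f^{\mathcal A}:(A,\mu_A)^{\mathrm{ar}(f)}\to(A,\mu_A)$ of $\mathbf{Fuz}_H$ and, for each $c\in C$, an element $c^{\mathcal A}\in A$. A morphism of $\Sigma$-algebras is an arrow of $\mathbf{Fuz}_H$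 between the carriers preserving all constants and commuting with all operations. An assignment is a function $\iota:X\to A$; evaluation: $x^{\mathcal A,\iota}=\iota(x)$, $c^{\mathcal A,\iota}=c^{\mathcal A}$, $f(t_1,\dots,t_n)^{\mathcal A,\iota}=f^{\mathcal A}(t_1^{\mathcal A,\iota},\dots,t_n^{\mathcal A,\iota})$. $\mathcal A\vDash_\iota s\equiv t$ iff $s^{\mathcal A,\iota}=t^{\mathcal A,\iota}$; $\mathcal A\vDash_\iota\mathsf E_l(t)$ iff $l\le\mu_A(t^{\mathcal A,\iota})$. $\mathcal A$ satisfies $\Gamma\vdash\psi$ if for every assignment $\iota$ with $\mathcal A\vDash_\iota\phi$ for all $\phi\in\Gamma$ one has $\mathcal A\vDash_\iota\psi$. $\mathcal A$ is a model of a theory $\Lambda$ if it satisfies every sequent of $\Lambda$. $\mathbf{Mod}(\Lambda)$ is the full subcategory of the category of $\Sigma$-algebras on the models of $\Lambda$, and $\mathscr U_\Lambda:\mathbf{Mod}(\Lambda)\to\mathbf{Fuz}_H$ is the forgetful functor to carriers. -}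

module Defs where

open import Level using (Level; Lift; lower; _⊔_) renaming (suc to lsuc)
open import Data.Empty using (⊥-elim) renaming (⊥ to Empty)
open import Data.Fin.Base using (Fin)
import Data.Fin.Base as Fin
open import Data.Nat.Base using (ℕ; zero; suc; NonZero)
open import Data.Product using (Σ; proj₁; ∃!)
open import Data.Vec.Functional using (Vector; foldr; map)
open import Data.Vec.Functional.Relation.Binary.Equality.Setoid using (≋-setoid)
open import Function.Bundles using (Func)
import Function.Construct.Composition as Composition
import Function.Construct.Identity as Identity
open import Relation.Binary.Bundles using (Setoid)
open import Relation.Binary.Lattice using (BoundedMeetSemilattice)
open import Relation.Binary.Structures using (IsEquivalence)
open import Relation.Unary using (Pred; _∈_)

-- Conventions.  A universe Set ℓ plays the role of the category of sets.
-- Sets whose elements get identified (carriers of fuzzy sets, frames,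
-- hom-sets) are setoids; sets of symbols and variables are types.

------------------------------------------------------------------------
-- Categories

record Category (o a e : Level) : Set (lsuc (o ⊔ a ⊔ e)) where
  infix  4 _≈_ _⇒_
  infixr 9 _∙_
  field
    Obj       : Set o
    _⇒_       : Obj → Obj → Set a
    _≈_       : ∀ {A B} → A ⇒ B → A ⇒ B → Set e
    id        : ∀ {A} → A ⇒ A
    _∙_       : ∀ {A B C} → B ⇒ C → A ⇒ B → A ⇒ C
    isEquiv   : ∀ {A B} → IsEquivalence (_≈_ {A} {B})
    ∙-cong    : ∀ {A B C} {f f′ : B ⇒ C} {g g′ : A ⇒ B} →
                f ≈ f′ → g ≈ g′ → f ∙ g ≈ f′ ∙ g′
    identityˡ : ∀ {A B} (f : A ⇒ B) → id ∙ f ≈ f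
    identityʳ : ∀ {A B} (f : A ⇒ B) → f ∙ id ≈ f
    assoc     : ∀ {A B C D} (f : C ⇒ D) (g : B ⇒ C) (h : A ⇒ B) →
                (f ∙ g) ∙ h ≈ f ∙ (g ∙ h)

FullSubcategory : ∀ {o a e p} (𝒞 : Category o a e) →
                  Pred (Category.Obj 𝒞) p → Category (o ⊔ p) a e
FullSubcategory 𝒞 P = record
  { Obj       = Σ Obj P
  ; _⇒_       = λ A B → proj₁ A ⇒ proj₁ B
  ; _≈_       = _≈_
  ; id        = id
  ; _∙_       = _∙_
  ; isEquiv   = isEquiv
  ; ∙-cong    = ∙-cong
  ; identityˡ = identityˡ
  ; identityʳ = identityʳ
  ; assoc     = assoc
  }
  where open Category 𝒞

record Functor {o a e o′ a′ e′} (𝒞 : Category o a e) (𝒟 : Category o′ a′ e′)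
       : Set (o ⊔ a ⊔ e ⊔ o′ ⊔ a′ ⊔ e′) where
  private
    module C = Category 𝒞
    module D = Category 𝒟
  field
    F₀     : C.Obj → D.Obj
    F₁     : ∀ {A B} → A C.⇒ B → F₀ A D.⇒ F₀ B
    F-cong : ∀ {A B} {f g : A C.⇒ B} → f C.≈ g → F₁ f D.≈ F₁ g
    F-id   : ∀ {A} → F₁ (C.id {A}) D.≈ D.id
    F-∙    : ∀ {A B C} (f : B C.⇒ C) (g : A C.⇒ B) →
             F₁ (f C.∙ g) D.≈ F₁ f D.∙ F₁ g

-- Adjunctions, presented by a natural unit all of whose components are
-- universal arrows to U.
infix 4 _⊣_

record _⊣_ {o a e o′ a′ e′} {𝒞 : Category o a e} {𝒟 : Category o′ a′ e′}
           (F : Functor 𝒞 𝒟) (U : Functor 𝒟 𝒞)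
       : Set (o ⊔ a ⊔ e ⊔ o′ ⊔ a′ ⊔ e′) where
  private
    module C = Category 𝒞
    module D = Category 𝒟
    module F = Functor F
    module U = Functor U
  field
    η         : ∀ M → M C.⇒ U.F₀ (F.F₀ M)
    η-natural : ∀ {M N} (f : M C.⇒ N) →
                U.F₁ (F.F₁ f) C.∙ η M C.≈ η N C.∙ f
    universal : ∀ M B (g : M C.⇒ U.F₀ B) →
                ∃! (D._≈_ {F.F₀ M} {B}) λ ḡ → U.F₁ ḡ C.∙ η M C.≈ g

------------------------------------------------------------------------
-- Frames

-- "Arbitrary joins" are joins of families indexed by any type in Set ℓ, the
-- universe of the carrier.  In particular every subset Pred Carrier ℓ has a
-- join.
record Frame (ℓ : Level) : Set (lsuc ℓ) where
  field
    boundedMeetSemilattice : BoundedMeetSemilattice ℓ ℓ ℓ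

  open BoundedMeetSemilattice boundedMeetSemilattice public

  field
    ⋁           : {I : Set ℓ} → (I → Carrier) → Carrier
    ⋁-upper     : {I : Set ℓ} (u : I → Carrier) → ∀ i → u i ≤ ⋁ u
    ⋁-least     : {I : Set ℓ} (u : I → Carrier) → ∀ y → (∀ i → u i ≤ y) → ⋁ u ≤ y
    ∧-distrib-⋁ : {I : Set ℓ} (x : Carrier) (u : I → Carrier) →
                  x ∧ ⋁ u ≈ ⋁ (λ i → x ∧ u i)

  ⊥ : Carrier
  ⊥ = ⋁ {I = Lift ℓ Empty} (λ i → ⊥-elim (lower i))

  ⋀ : ∀ {n} → Vector Carrier n → Carrier
  ⋀ = foldr _∧_ ⊤

  ⋀-mono : ∀ {n} {u v : Vector Carrier n} → (∀ i → u i ≤ v i) → ⋀ u ≤ ⋀ v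
  ⋀-mono {zero}          u≤v = refl
  ⋀-mono {suc n} {u} {v} u≤v =
    ∧-greatest (trans (x∧y≤x _ _) (u≤v Fin.zero))
               (trans (x∧y≤y _ _) (⋀-mono (λ i → u≤v (Fin.suc i))))

  ⋀-cong : ∀ {n} {u v : Vector Carrier n} → (∀ i → u i ≈ v i) → ⋀ u ≈ ⋀ v
  ⋀-cong u≈v = antisym (⋀-mono (λ i → reflexive (u≈v i)))
                       (⋀-mono (λ i → reflexive (Eq.sym (u≈v i))))

------------------------------------------------------------------------
-- Signatures, languages and terms

record Signature (ℓ : Level) : Set (lsuc ℓ) where
  field
    O          : Set ℓ
    ar         : O → ℕ
    ar-nonZero : ∀ f → NonZero (ar f)
    C          : Set ℓ

record Language (ℓ : Level) : Set (lsuc ℓ) where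
  field
    signature : Signature ℓ
    X         : Set ℓ

data Term {ℓ} (S : Signature ℓ) (X : Set ℓ) : Set ℓ where
  var   : X → Term S X
  const : Signature.C S → Term S X
  op    : (f : Signature.O S) → Vector (Term S X) (Signature.ar S f) → Term S X

Terms : ∀ {ℓ} → Language ℓ → Set ℓ
Terms 𝓛 = Term (Language.signature 𝓛) (Language.X 𝓛)

------------------------------------------------------------------------
-- Everything below is relative to the frame H

module _ {ℓ : Level} (H : Frame ℓ) where

  private
    module H = Frame H

  data Formula (𝓛 : Language ℓ) : Set ℓ where
    _≣_ : Terms 𝓛 → Terms 𝓛 → Formula 𝓛
    E   : H.Carrier → Terms 𝓛 → Formula 𝓛

  record Sequent (𝓛 : Language ℓ) : Set (lsuc ℓ) where
    constructor _⊢_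
    field
      premises   : Pred (Formula 𝓛) ℓ
      conclusion : Formula 𝓛

  -- Subsets of a type are types in Set (lsuc ℓ), hence so is Sequent 𝓛; a
  -- (small) set of sequents is given as the image of a family.
  record Theory (𝓛 : Language ℓ) : Set (lsuc ℓ) where
    field
      Index   : Set ℓ
      sequent : Index → Sequent 𝓛

  record FuzzySet : Set (lsuc ℓ) where
    field
      setoid : Setoid ℓ ℓ
    open Setoid setoid public
    field
      μ      : Carrier → H.Carrier
      μ-cong : ∀ {x y} → x ≈ y → μ x H.≈ μ y

  record FuzzyMap (A B : FuzzySet) : Set ℓ where
    private
      module A = FuzzySet A
      module B = FuzzySet B
    field
      func : Func A.setoid B.setoid
    open Func func public using (to; cong)
    field
      μ-≤  : ∀ x → A.μ x H.≤ B.μ (to x)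

  Fuz : Category (lsuc ℓ) ℓ ℓ
  Fuz = record
    { Obj       = FuzzySet
    ; _⇒_       = FuzzyMap
    ; _≈_       = λ {_} {B} f g → ∀ x → FuzzySet._≈_ B (to f x) (to g x)
    ; id        = record { func = Identity.function _ ; μ-≤ = λ _ → H.refl }
    ; _∙_       = λ g f → record
      { func = Composition.function (func f) (func g)
      ; μ-≤  = λ x → H.trans (μ-≤ f x) (μ-≤ g (to f x))
      }
    ; isEquiv   = λ {_} {B} → record
      { refl  = λ _ → FuzzySet.refl B
      ; sym   = λ p x → FuzzySet.sym B (p x)
      ; trans = λ p q x → FuzzySet.trans B (p x) (q x)
      }
    ; ∙-cong    = λ {_} {_} {C} {f} {_} {_} {g′} p q x →
                    FuzzySet.trans C (cong f (q x)) (p (to g′ x))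
    ; identityˡ = λ {_} {B} _ _ → FuzzySet.refl B
    ; identityʳ = λ {_} {B} _ _ → FuzzySet.refl B
    ; assoc     = λ {_} {_} {_} {D} _ _ _ _ → FuzzySet.refl D
    }
    where open FuzzyMap

  infix 8 _^_

  _^_ : FuzzySet → ℕ → FuzzySet
  A ^ n = record
    { setoid = ≋-setoid A.setoid n
    ; μ      = λ as → H.⋀ (map A.μ as)
    ; μ-cong = λ as≈bs → H.⋀-cong (λ i → A.μ-cong (as≈bs i))
    }
    where module A = FuzzySet A

  module _ (S : Signature ℓ) where

    open Signature S

    record Algebra : Set (lsuc ℓ) where
      field
        carrier : FuzzySet
      open FuzzySet carrier public
      field
        ⟦_⟧ᵒ : (f : O) → FuzzyMap (carrier ^ ar f) carrier
        ⟦_⟧ᶜ : C → Carrier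

      apply : (f : O) → Vector Carrier (ar f) → Carrier
      apply f = FuzzyMap.to ⟦ f ⟧ᵒ

    record AlgebraMap (𝓐 𝓑 : Algebra) : Set ℓ where
      private
        module A = Algebra 𝓐
        module B = Algebra 𝓑
      field
        arrow : FuzzyMap A.carrier B.carrier
      open FuzzyMap arrow public
      field
        pres-const : ∀ c → to A.⟦ c ⟧ᶜ B.≈ B.⟦ c ⟧ᶜ
        pres-op    : ∀ f (as : Vector A.Carrier (ar f)) →
                     to (A.apply f as) B.≈ B.apply f (map to as)

    Alg : Category (lsuc ℓ) ℓ ℓ
    Alg = record
      { Obj       = Algebra
      ; _⇒_       = AlgebraMap
      ; _≈_       = λ f g → arrow f F.≈ arrow g
      ; id        = λ {𝓐} → record
        { arrow      = F.id
        ; pres-const = λ _ → Algebra.refl 𝓐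
        ; pres-op    = λ _ _ → Algebra.refl 𝓐
        }
      ; _∙_       = λ {_} {_} {𝓒} g f → record
        { arrow      = arrow g F.∙ arrow f
        ; pres-const = λ c →
            Algebra.trans 𝓒 (cong g (pres-const f c)) (pres-const g c)
        ; pres-op    = λ o as →
            Algebra.trans 𝓒 (cong g (pres-op f o as)) (pres-op g o (map (to f) as))
        }
      ; isEquiv   = λ {𝓐} {𝓑} → record
        { refl  = λ _ → Algebra.refl 𝓑
        ; sym   = λ p x → Algebra.sym 𝓑 (p x)
        ; trans = λ p q x → Algebra.trans 𝓑 (p x) (q x)
        }
      ; ∙-cong    = λ {_} {_} {_} {f} {f′} {g} {g′} →
                      F.∙-cong {f = arrow f} {arrow f′} {arrow g} {arrow g′}
      ; identityˡ = λ f → F.identityˡ (arrow f)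
      ; identityʳ = λ f → F.identityʳ (arrow f)
      ; assoc     = λ f g h → F.assoc (arrow f) (arrow g) (arrow h)
      }
      where
      open AlgebraMap
      module F = Category Fuz

    eval : (𝓐 : Algebra) {X : Set ℓ} → (X → Algebra.Carrier 𝓐) →
           Term S X → Algebra.Carrier 𝓐
    eval 𝓐 ι (var x)   = ι x
    eval 𝓐 ι (const c) = Algebra.⟦_⟧ᶜ 𝓐 c
    eval 𝓐 ι (op f ts) = Algebra.apply 𝓐 f (λ i → eval 𝓐 ι (ts i))

  module _ {𝓛 : Language ℓ} where

    open Language 𝓛

    infix 4 _⟨_⟩⊨_ _⊨_

    _⟨_⟩⊨_ : (𝓐 : Algebra signature) → (X → Algebra.Carrier 𝓐) → Formula 𝓛 → Set ℓ
    𝓐 ⟨ ι ⟩⊨ (s ≣ t) = Algebra._≈_ 𝓐 (eval signature 𝓐 ι s) (eval signature 𝓐 ι t)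
    𝓐 ⟨ ι ⟩⊨ (E l t) = l H.≤ Algebra.μ 𝓐 (eval signature 𝓐 ι t)

    _⊨_ : Algebra signature → Sequent 𝓛 → Set ℓ
    𝓐 ⊨ (Γ ⊢ ψ) = (ι : X → Algebra.Carrier 𝓐) →
                  (∀ φ → φ ∈ Γ → 𝓐 ⟨ ι ⟩⊨ φ) → 𝓐 ⟨ ι ⟩⊨ ψ

    IsModel : Theory 𝓛 → Pred (Algebra signature) ℓ
    IsModel Λ 𝓐 = ∀ j → 𝓐 ⊨ Theory.sequent Λ j

    Mod : Theory 𝓛 → Category (lsuc ℓ) ℓ ℓ
    Mod Λ = FullSubcategory (Alg signature) (IsModel Λ)

    forgetful : (Λ : Theory 𝓛) → Functor (Mod Λ) Fuz
    forgetful Λ = record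
      { F₀     = λ 𝓐 → Algebra.carrier (proj₁ 𝓐)
      ; F₁     = AlgebraMap.arrow
      ; F-cong = λ f≈g → f≈g
      ; F-id   = λ {𝓐} _ → Algebra.refl (proj₁ 𝓐)
      ; F-∙    = λ {_} {_} {𝓒} _ _ _ → Algebra.refl (proj₁ 𝓒)
      }

{-# OPTIONS --safe #-}
-- The free model on M consists of terms over M modulo derivable equality.
-- Writing down derivability and the membership degrees simultaneously would
-- need joins over derivations inside the derivations themselves.  Instead fix a
-- candidate degree ν on terms and let derivations use l ≤ ν t as an axiom for
-- E l t.  Call ν closed if every derivable E l t already satisfies l ≤ ν t.
-- Functions from terms to the frame form a small complete lattice and
-- derivability is monotone in ν, so the pointwise meet of all closed ν is the
-- least closed one: it is the degree of the free model.  For a model B and an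
-- arrow g from M to B, soundness says that the degree in B of the value of a
-- term is closed; hence it lies above the least one, and evaluation is a
-- morphism from the free model to B.
module Submission where

open import Defs
open import Level using (Level)
open import Data.Product using (Σ; Σ-syntax; ∃!; _,_; proj₁; proj₂)
open import Data.Vec.Functional using (Vector)
open import Relation.Binary.Structures using (IsEquivalence)
open import Relation.Unary using (_∈_)

-- Universal arrows

module _ {o a e o′ a′ e′} {𝒞 : Category o a e} {𝒟 : Category o′ a′ e′}
         (U : Functor 𝒟 𝒞) where

  private
    module C = Category 𝒞
    module D = Category 𝒟
    module U = Functor U
    module CE {A B} = IsEquivalence (C.isEquiv {A} {B})

  module _ (F₀ : C.Obj → D.Obj)
           (η : ∀ M → M C.⇒ U.F₀ (F₀ M))
           (universal : ∀ M B (g : M C.⇒ U.F₀ B) →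
                        ∃! (D._≈_ {F₀ M} {B}) λ ḡ → U.F₁ ḡ C.∙ η M C.≈ g)
           where

    private
      F₁ : ∀ {M N} → M C.⇒ N → F₀ M D.⇒ F₀ N
      F₁ f = proj₁ (universal _ _ (η _ C.∙ f))

      F₁-η : ∀ {M N} (f : M C.⇒ N) → U.F₁ (F₁ f) C.∙ η M C.≈ η N C.∙ f
      F₁-η f = proj₁ (proj₂ (universal _ _ (η _ C.∙ f)))

      F₁-unique : ∀ {M N} (f : M C.⇒ N) {h : F₀ M D.⇒ F₀ N} →
                  U.F₁ h C.∙ η M C.≈ η N C.∙ f → F₁ f D.≈ h
      F₁-unique f = proj₂ (proj₂ (universal _ _ (η _ C.∙ f)))

    -- Uniqueness of factorisations makes `F₁` functorial: each law holds because its right-hand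
    -- side also solves the equation that determines its left-hand side.
    universalArrows⇒leftAdjoint : Σ[ F ∈ Functor 𝒞 𝒟 ] F ⊣ U
    universalArrows⇒leftAdjoint = F , record
      { η         = η
      ; η-natural = F₁-η
      ; universal = universal
      }
      where
      F : Functor 𝒞 𝒟
      F = record
        { F₀     = F₀
        ; F₁     = F₁
        ; F-cong = λ {_} {_} {f} {g} f≈g →
            F₁-unique f (CE.trans (F₁-η g) (C.∙-cong CE.refl (CE.sym f≈g)))
        ; F-id   = F₁-unique C.id
            (CE.trans (C.∙-cong U.F-id CE.refl)
            (CE.trans (C.identityˡ (η _)) (CE.sym (C.identityʳ (η _)))))
        ; F-∙    = λ f g → F₁-unique (f C.∙ g)
            (CE.trans (C.∙-cong (U.F-∙ (F₁ f) (F₁ g)) CE.refl)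
            (CE.trans (C.assoc (U.F₁ (F₁ f)) (U.F₁ (F₁ g)) (η _))
            (CE.trans (C.∙-cong CE.refl (F₁-η g))
            (CE.trans (CE.sym (C.assoc (U.F₁ (F₁ f)) (η _) g))
            (CE.trans (C.∙-cong (F₁-η f) CE.refl)
                      (C.assoc (η _) f g))))))
        }

-- Meets in a frame

module _ {ℓ} (H : Frame ℓ) where

  private
    module H = Frame H

  -- The join of all lower bounds; these form a type in `Set ℓ`, so `H.⋁` applies to them.
  inf : {I : Set ℓ} → (I → H.Carrier) → H.Carrier
  inf u = H.⋁ {I = Σ[ l ∈ H.Carrier ] (∀ i → l H.≤ u i)} proj₁

  inf-lower : {I : Set ℓ} (u : I → H.Carrier) → ∀ i → inf u H.≤ u i
  inf-lower u i = H.⋁-least proj₁ (u i) (λ (_ , l≤u) → l≤u i)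

  inf-greatest : {I : Set ℓ} (u : I → H.Carrier) →
                 ∀ l → (∀ i → l H.≤ u i) → l H.≤ inf u
  inf-greatest u l l≤u = H.⋁-upper proj₁ (l , l≤u)

-- Substitution

subst : ∀ {ℓ} {S : Signature ℓ} {X Y : Set ℓ} →
        (X → Term S Y) → Term S X → Term S Y
subst σ (var x)   = σ x
subst σ (const c) = const c
subst σ (op f ts) = op f (λ i → subst σ (ts i))

module _ {ℓ} (H : Frame ℓ) {S : Signature ℓ} where

  substᶠ : ∀ {X Y : Set ℓ} → (X → Term S Y) →
           Formula H (record { signature = S ; X = X }) →
           Formula H (record { signature = S ; X = Y })
  substᶠ σ (s ≣ t) = subst σ s ≣ subst σ t
  substᶠ σ (E l t) = E l (subst σ t)

  module _ (𝓐 : Algebra H S) where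

    private
      module A = Algebra 𝓐

    eval-subst : ∀ {X Y : Set ℓ} (ι : Y → A.Carrier) (σ : X → Term S Y) t →
                 eval H S 𝓐 ι (subst σ t) A.≈ eval H S 𝓐 (λ x → eval H S 𝓐 ι (σ x)) t
    eval-subst ι σ (var x)   = A.refl
    eval-subst ι σ (const c) = A.refl
    eval-subst ι σ (op f ts) =
      FuzzyMap.cong A.⟦ f ⟧ᵒ (λ i → eval-subst ι σ (ts i))

    module _ {X Y : Set ℓ} (ι : Y → A.Carrier) (σ : X → Term S Y) where

      private
        module H = Frame H

        ισ : X → A.Carrier
        ισ x = eval H S 𝓐 ι (σ x)

      ⊨-subst⁻ : ∀ φ → _⟨_⟩⊨_ H 𝓐 ι (substᶠ σ φ) → _⟨_⟩⊨_ H 𝓐 ισ φ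
      ⊨-subst⁻ (s ≣ t) p =
        A.trans (A.sym (eval-subst ι σ s)) (A.trans p (eval-subst ι σ t))
      ⊨-subst⁻ (E l t) p =
        H.trans p (H.reflexive (A.μ-cong (eval-subst ι σ t)))

      ⊨-subst⁺ : ∀ φ → _⟨_⟩⊨_ H 𝓐 ισ φ → _⟨_⟩⊨_ H 𝓐 ι (substᶠ σ φ)
      ⊨-subst⁺ (s ≣ t) p =
        A.trans (eval-subst ι σ s) (A.trans p (A.sym (eval-subst ι σ t)))
      ⊨-subst⁺ (E l t) p =
        H.trans p (H.reflexive (A.μ-cong (A.sym (eval-subst ι σ t))))

-- The free model

module _ {ℓ} (H : Frame ℓ) (𝓛 : Language ℓ) (Λ : Theory H 𝓛) (M : FuzzySet H) where

  private
    module H = Frame H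
    module M = FuzzySet M
    open Language 𝓛 renaming (signature to S)
    open Signature S
    module Λ {j} = Sequent (Theory.sequent Λ j)

  Tm : Set ℓ
  Tm = Term S M.Carrier

  Fm : Set ℓ
  Fm = Formula H (record { signature = S ; X = M.Carrier })

  -- No rule lowers a degree or joins several: for closed `ν` both follow by passing through `ν`
  -- with `E-ν`. The rule `axiom` branches over possibly infinitely many premises.
  data Derivable (ν : Tm → H.Carrier) : Fm → Set ℓ where
    ≣-refl  : ∀ {t} → Derivable ν (t ≣ t)
    ≣-sym   : ∀ {s t} → Derivable ν (s ≣ t) → Derivable ν (t ≣ s)
    ≣-trans : ∀ {s t u} → Derivable ν (s ≣ t) → Derivable ν (t ≣ u) →
              Derivable ν (s ≣ u)
    ≣-op    : ∀ f {ss ts : Vector Tm (ar f)} →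
              (∀ i → Derivable ν (ss i ≣ ts i)) → Derivable ν (op f ss ≣ op f ts)
    ≣-var   : ∀ {m n} → m M.≈ n → Derivable ν (var m ≣ var n)
    E-ν     : ∀ {l t} → l H.≤ ν t → Derivable ν (E l t)
    E-resp  : ∀ {l s t} → Derivable ν (s ≣ t) → Derivable ν (E l s) →
              Derivable ν (E l t)
    E-op    : ∀ f {ls : Vector H.Carrier (ar f)} {ts} →
              (∀ i → Derivable ν (E (ls i) (ts i))) →
              Derivable ν (E (H.⋀ ls) (op f ts))
    E-var   : ∀ m → Derivable ν (E (M.μ m) (var m))
    axiom   : ∀ j (σ : X → Tm) →
              (∀ φ → φ ∈ Λ.premises {j} → Derivable ν (substᶠ H σ φ)) →
              Derivable ν (substᶠ H σ (Λ.conclusion {j}))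

  Derivable-mono : ∀ {ν ν′} → (∀ t → ν t H.≤ ν′ t) →
                   ∀ {φ} → Derivable ν φ → Derivable ν′ φ
  Derivable-mono ν≤ ≣-refl        = ≣-refl
  Derivable-mono ν≤ (≣-sym d)     = ≣-sym (Derivable-mono ν≤ d)
  Derivable-mono ν≤ (≣-trans d e) =
    ≣-trans (Derivable-mono ν≤ d) (Derivable-mono ν≤ e)
  Derivable-mono ν≤ (≣-op f ds)   = ≣-op f (λ i → Derivable-mono ν≤ (ds i))
  Derivable-mono ν≤ (≣-var m≈n)   = ≣-var m≈n
  Derivable-mono ν≤ (E-ν l≤)      = E-ν (H.trans l≤ (ν≤ _))
  Derivable-mono ν≤ (E-resp d e)  =
    E-resp (Derivable-mono ν≤ d) (Derivable-mono ν≤ e)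
  Derivable-mono ν≤ (E-op f ds)   = E-op f (λ i → Derivable-mono ν≤ (ds i))
  Derivable-mono ν≤ (E-var m)     = E-var m
  Derivable-mono ν≤ (axiom j σ p) =
    axiom j σ (λ φ φ∈Γ → Derivable-mono ν≤ (p φ φ∈Γ))

  -- The least closed degree

  Closed : (Tm → H.Carrier) → Set ℓ
  Closed ν = ∀ l t → Derivable ν (E l t) → l H.≤ ν t

  degree : Tm → H.Carrier
  degree t = inf H {I = Σ (Tm → H.Carrier) Closed} (λ (ν , _) → ν t)

  degree-least : ∀ {ν} → Closed ν → ∀ t → degree t H.≤ ν t
  degree-least closed t = inf-lower H _ (_ , closed)

  -- As in the Knaster-Tarski theorem: `degree` lies below each closed `ν`, so a derivation over
  -- `degree` is also one over `ν`, which bounds `l` by `ν t`.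
  degree-closed : Closed degree
  degree-closed l t d = inf-greatest H _ l
    (λ (ν , closed) → closed l t (Derivable-mono (degree-least closed) d))

  degree-resp : ∀ {s t} → Derivable degree (s ≣ t) → degree s H.≤ degree t
  degree-resp d = degree-closed _ _ (E-resp d (E-ν H.refl))

  -- The term model

  free : Algebra H S
  free = record
    { carrier = record
      { setoid = record
        { Carrier       = Tm
        ; _≈_           = λ s t → Derivable degree (s ≣ t)
        ; isEquivalence = record { refl = ≣-refl ; sym = ≣-sym ; trans = ≣-trans }
        }
      ; μ      = degree
      ; μ-cong = λ d → H.antisym (degree-resp d) (degree-resp (≣-sym d))
      }
    ; ⟦_⟧ᵒ    = λ f → record
      { func = record { to = op f ; cong = ≣-op f }
      -- `E-op` is used with each argument at its own degree.
      ; μ-≤  = λ ts → degree-closed _ _ (E-op f (λ i → E-ν H.refl))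
      }
    ; ⟦_⟧ᶜ    = const
    }

  -- Only derivable, not propositional: operations take functions as arguments,
  -- so pointwise equal arguments need not give equal terms.
  eval-free : (σ : X → Tm) → ∀ t → Derivable degree (eval H S free σ t ≣ subst σ t)
  eval-free σ (var x)   = ≣-refl
  eval-free σ (const c) = ≣-refl
  eval-free σ (op f ts) = ≣-op f (λ i → eval-free σ (ts i))

  ⊨⇒derivable : (σ : X → Tm) → ∀ φ → _⟨_⟩⊨_ H free σ φ → Derivable degree (substᶠ H σ φ)
  ⊨⇒derivable σ (s ≣ t) d =
    ≣-trans (≣-sym (eval-free σ s)) (≣-trans d (eval-free σ t))
  ⊨⇒derivable σ (E l t) l≤ = E-resp (eval-free σ t) (E-ν l≤)

  derivable⇒⊨ : (σ : X → Tm) → ∀ φ → Derivable degree (substᶠ H σ φ) → _⟨_⟩⊨_ H free σ φ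
  derivable⇒⊨ σ (s ≣ t) d =
    ≣-trans (eval-free σ s) (≣-trans d (≣-sym (eval-free σ t)))
  derivable⇒⊨ σ (E l t) d =
    degree-closed _ _ (E-resp (≣-sym (eval-free σ t)) d)

  -- An assignment into terms is a substitution, so each sequent of `Λ` becomes an instance of
  -- `axiom`.
  free-isModel : IsModel H Λ free
  free-isModel j σ p =
    derivable⇒⊨ σ _ (axiom j σ (λ φ φ∈Γ → ⊨⇒derivable σ φ (p φ φ∈Γ)))

  unit : FuzzyMap H M (Algebra.carrier free)
  unit = record
    { func = record { to = var ; cong = ≣-var }
    ; μ-≤  = λ m → degree-closed _ _ (E-var m)
    }

  -- Universal property of the term model

  module _ (𝓑 : Algebra H S) (𝓑-isModel : IsModel H Λ 𝓑)
           (g : FuzzyMap H M (Algebra.carrier 𝓑)) where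

    private
      module B = Algebra 𝓑
      module g = FuzzyMap g

    ⟦_⟧ : Tm → B.Carrier
    ⟦_⟧ = eval H S 𝓑 g.to

    -- With the degree pulled back from `𝓑` as candidate, `E-ν` is true by definition. For `axiom`,
    -- the model property is used at the assignment that evaluates `σ`.
    sound : ∀ φ → Derivable (λ t → B.μ ⟦ t ⟧) φ → _⟨_⟩⊨_ H 𝓑 g.to φ
    sound _ ≣-refl        = B.refl
    sound _ (≣-sym d)     = B.sym (sound _ d)
    sound _ (≣-trans d e) = B.trans (sound _ d) (sound _ e)
    sound _ (≣-op f ds)   = FuzzyMap.cong B.⟦ f ⟧ᵒ (λ i → sound _ (ds i))
    sound _ (≣-var m≈n)   = g.cong m≈n
    sound _ (E-ν l≤)      = l≤
    sound _ (E-resp d e)  = H.trans (sound _ e) (H.reflexive (B.μ-cong (sound _ d)))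
    sound _ (E-op f ds)   =
      H.trans (H.⋀-mono (λ i → sound _ (ds i))) (FuzzyMap.μ-≤ B.⟦ f ⟧ᵒ _)
    sound _ (E-var m)     = g.μ-≤ m
    sound _ (axiom j σ p) =
      ⊨-subst⁺ H 𝓑 g.to σ Λ.conclusion
        (𝓑-isModel j _ (λ φ φ∈Γ → ⊨-subst⁻ H 𝓑 g.to σ φ (sound _ (p φ φ∈Γ))))

    degree≤ : ∀ t → degree t H.≤ B.μ ⟦ t ⟧
    degree≤ = degree-least (λ l t → sound (E l t))

    extend : AlgebraMap H S free 𝓑
    extend = record
      { arrow      = record
        { func = record
          { to   = ⟦_⟧
          -- Equality in `free` is derived over `degree`; monotonicity moves it to the pulled-back
          -- degree, where soundness applies.
          ; cong = λ d → sound (_ ≣ _) (Derivable-mono degree≤ d)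
          }
        ; μ-≤  = degree≤
        }
      ; pres-const = λ _ → B.refl
      ; pres-op    = λ _ _ → B.refl
      }

    -- Variables, constants and operations generate all terms, and `h` is prescribed on each.
    extend-unique : (h : AlgebraMap H S free 𝓑) →
                    (∀ m → AlgebraMap.to h (var m) B.≈ g.to m) →
                    ∀ t → ⟦ t ⟧ B.≈ AlgebraMap.to h t
    extend-unique h h∘var≈g (var m)   = B.sym (h∘var≈g m)
    extend-unique h h∘var≈g (const c) = B.sym (AlgebraMap.pres-const h c)
    extend-unique h h∘var≈g (op f ts) =
      B.trans (FuzzyMap.cong B.⟦ f ⟧ᵒ (λ i → extend-unique h h∘var≈g (ts i)))
              (B.sym (AlgebraMap.pres-op h f ts))

theorem33 : ∀ {ℓ : Level} (H : Frame ℓ) (𝓛 : Language ℓ) (Λ : Theory H 𝓛) →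
    Σ[ F ∈ Functor (Fuz H) (Mod H Λ) ] F ⊣ forgetful H Λ
theorem33 H 𝓛 Λ = universalArrows⇒leftAdjoint (forgetful H Λ)
  (λ M → free H 𝓛 Λ M , free-isModel H 𝓛 Λ M)
  (unit H 𝓛 Λ)
  (λ M (𝓑 , 𝓑-isModel) g →
      extend H 𝓛 Λ M 𝓑 𝓑-isModel g
    , (λ _ → Algebra.refl 𝓑)
    , λ {h} → extend-unique H 𝓛 Λ M 𝓑 𝓑-isModel g h)
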